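{- For all natural numbers $n\geq 1$, \[a_4(n)=4p(n)-p(n+1)-2p(n+2)-2p(n+3)+p(n+4)+2p(n+5)-p(n+6).\]
   Context: $p(n)$ denotes the number of partitions of $n$. $a_4(n)$ denotes the number of partitions of $n$ in which the smallest part occurs at least $4$ times. -}

module Defs where

open import Data.List.Base using (List; []; _∷_; [_]; _++_; map; filter; length)
open import Data.List.Extrema.Nat using (min)
open import Data.List.Membership.Propositional using (_∈_)
open import Data.List.Membership.Propositional.Properties
  using (∈-map⁺; ∈-map⁻; ∈-++⁺ˡ; ∈-++⁺ʳ; ∈-++⁻; ∈-filter⁺; ∈-filter⁻)
open import Data.List.Relation.Binary.Disjoint.Propositional using (Disjoint)
open import Data.List.Relation.Unary.All using (All; []; _∷_)
open import Data.List.Relation.Unary.AllPairs using ([]; _∷_)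
open import Data.List.Relation.Unary.Any using (here)
open import Data.List.Relation.Unary.Unique.Propositional using (Unique)
open import Data.List.Relation.Unary.Unique.Propositional.Properties using (map⁺; ++⁺; filter⁺)
open import Data.Nat.Base using (ℕ; zero; suc; _<_; z<s; s≤s)
open import Data.Nat.ListAction using (sum)
open import Data.Nat.Properties using (_≟_; _≤?_; ≤-totalOrder; suc-injective)
open import Data.List.Relation.Unary.Sorted.TotalOrder ≤-totalOrder using (Sorted; sorted?)
open import Data.Product.Base using (_×_; _,_; proj₁; proj₂)
open import Data.Sum.Base using (inj₁; inj₂)
open import Function.Bundles using (_⇔_; mk⇔)
open import Relation.Binary.PropositionalEquality.Core using (_≡_; refl; cong)

-- A partition is written as the nondecreasing list of its parts.
record IsPartition (n : ℕ) (π : List ℕ) : Set where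
  constructor isPartition
  field
    sorted   : Sorted π
    positive : All (0 <_) π
    total    : sum π ≡ n

incHead : List ℕ → List ℕ
incHead []       = []
incHead (x ∷ xs) = suc x ∷ xs

-- All lists of positive integers with sum n: for n ≥ 2 such a list either
-- starts with 1 or arises by increasing the first entry of one with sum n - 1.
compositions : ℕ → List (List ℕ)
compositions 0             = [ [] ]
compositions 1             = [ [ 1 ] ]
compositions (suc (suc n)) =
  map (1 ∷_) (compositions (suc n)) ++ map incHead (compositions (suc n))

-- The list of all partitions of n, each occurring exactly once; this is what
-- ∈-partitions and partitions-unique below establish.
partitions : ℕ → List (List ℕ)
partitions n = filter (sorted? _≤?_) (compositions n)

p : ℕ → ℕ
p n = length (partitions n)

multiplicity : ℕ → List ℕ → ℕ
multiplicity k π = length (filter (_≟ k) π)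

-- The empty partition has no smallest part and gets the value 0.
smallestPartMultiplicity : List ℕ → ℕ
smallestPartMultiplicity []       = 0
smallestPartMultiplicity (x ∷ xs) = multiplicity (min x xs) (x ∷ xs)

a₄ : ℕ → ℕ
a₄ n = length (filter (λ π → 4 ≤? smallestPartMultiplicity π) (partitions n))

compositions-sound : ∀ n {π} → π ∈ compositions n → All (0 <_) π × sum π ≡ n
compositions-sound 0 (here refl) = [] , refl
compositions-sound 1 (here refl) = z<s ∷ [] , refl
compositions-sound (suc (suc n)) = step (compositions-sound (suc n))
  where
  step : (∀ {π} → π ∈ compositions (suc n) → All (0 <_) π × sum π ≡ suc n) →
         ∀ {π} → π ∈ compositions (suc (suc n)) → All (0 <_) π × sum π ≡ suc (suc n)
  step ih π∈ with ∈-++⁻ (map (1 ∷_) (compositions (suc n))) π∈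
  step ih π∈ | inj₁ i with _ , ρ∈ , refl ← ∈-map⁻ (1 ∷_) i
                      with pos , eq ← ih ρ∈ = z<s ∷ pos , cong suc eq
  step ih π∈ | inj₂ i with ∈-map⁻ incHead i
  ... | []    , ρ∈ , refl with () ← proj₂ (ih ρ∈)
  ... | _ ∷ _ , ρ∈ , refl with _ ∷ pos , eq ← ih ρ∈ = z<s ∷ pos , cong suc eq

compositions-complete : ∀ n {π} → All (0 <_) π → sum π ≡ n → π ∈ compositions n
compositions-complete 0 [] refl = here refl
compositions-complete 0 (s≤s _ ∷ _) ()
compositions-complete 1 {zero ∷ _} (() ∷ _) _
compositions-complete 1 {1 ∷ []} _ refl = here refl
compositions-complete 1 {1 ∷ zero ∷ _} (_ ∷ () ∷ _) _
compositions-complete 1 {1 ∷ suc _ ∷ _} _ ()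
compositions-complete (suc (suc n)) {zero ∷ _} (() ∷ _) _
compositions-complete (suc (suc n)) {1 ∷ π} (_ ∷ pos) eq =
  ∈-++⁺ˡ (∈-map⁺ (1 ∷_) (compositions-complete (suc n) pos (suc-injective eq)))
compositions-complete (suc (suc n)) {suc (suc x) ∷ π} (_ ∷ pos) eq =
  ∈-++⁺ʳ (map (1 ∷_) (compositions (suc n)))
    (∈-map⁺ incHead (compositions-complete (suc n) (z<s {x} ∷ pos) (suc-injective eq)))

incHead-injective : ∀ {π ρ} → incHead π ≡ incHead ρ → π ≡ ρ
incHead-injective {[]}    {[]}    refl = refl
incHead-injective {_ ∷ _} {_ ∷ _} refl = refl

compositions-unique : ∀ n → Unique (compositions n)
compositions-unique 0             = [] ∷ []
compositions-unique 1             = [] ∷ []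
compositions-unique (suc (suc n)) =
  ++⁺ (map⁺ (λ { refl → refl }) (compositions-unique (suc n)))
      (map⁺ incHead-injective (compositions-unique (suc n)))
      disjoint
  where
  disjoint : Disjoint (map (1 ∷_) (compositions (suc n))) (map incHead (compositions (suc n)))
  disjoint (i , j) with ∈-map⁻ (1 ∷_) i | ∈-map⁻ incHead j
  ... | _ , _ , refl | zero ∷ _ , ρ∈ , refl
    with () ∷ _ ← proj₁ (compositions-sound (suc n) ρ∈)

∈-partitions : ∀ n {π} → π ∈ partitions n ⇔ IsPartition n π
∈-partitions n = mk⇔ to from
  where
  to : ∀ {π} → π ∈ partitions n → IsPartition n π
  to π∈ with c , s ← ∈-filter⁻ (sorted? _≤?_) {xs = compositions n} π∈
        with pos , eq ← compositions-sound n c = isPartition s pos eq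
  from : ∀ {π} → IsPartition n π → π ∈ partitions n
  from (isPartition s pos eq) = ∈-filter⁺ (sorted? _≤?_) (compositions-complete n pos eq) s

partitions-unique : ∀ n → Unique (partitions n)
partitions-unique n = filter⁺ (sorted? _≤?_) (compositions-unique n)

{-# OPTIONS --safe #-}
-- Let a_k(n) count the partitions of n whose smallest part occurs at least k
-- times. For k ≥ 1, take a partition of n + k counted by a_k and lower k copies
-- of its smallest part x by 1. If x = 1, dropping the resulting zeros leaves an
-- arbitrary partition of n; otherwise the result is a partition of n whose
-- smallest part occurs exactly k times. Hence
--   a_k(n + k) = p(n) + (a_k(n) - a_{k+1}(n)),
-- and unfolding this from a_4 down to a_1(n) = p(n), n ≥ 1, gives the formula.
module Submission where

open import Defs
open import Data.Nat.Base as ℕ using (ℕ)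
open import Data.Integer.Base using (+_; _+_; _-_; _*_)
open import Relation.Binary.PropositionalEquality.Core using (_≡_)

open import Data.Integer.Tactic.RingSolver using (solve-∀)
open import Data.List.Base using (List; []; _∷_; _++_; map; filter; length; replicate)
open import Data.List.Extrema.Nat using (min; min≤⊤; v≤min⁺)
open import Data.List.Membership.Propositional using (_∈_)
open import Data.List.Membership.Propositional.Properties
  using (∈-map⁺; ∈-map⁻; ∈-++⁺ˡ; ∈-++⁺ʳ; ∈-++⁻; ∈-filter⁺; ∈-filter⁻)
open import Data.List.Membership.Propositional.Properties.WithK using (unique∧set⇒bag)
open import Data.List.Properties
  using (length-map; length-++; filter-accept; filter-reject; filter-none; filter-all;
         ++-cancelˡ; ∷-injective)
open import Data.List.Relation.Binary.BagAndSetEquality using (∼bag⇒↭)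
open import Data.List.Relation.Binary.Disjoint.Propositional using (Disjoint)
open import Data.List.Relation.Binary.Permutation.Propositional.Properties using (↭-length)
open import Data.List.Relation.Unary.All as All using (All; []; _∷_)
import Data.List.Relation.Unary.All.Properties as All
open import Data.List.Relation.Unary.AllPairs using (AllPairs; []; _∷_)
open import Data.List.Relation.Unary.Sorted.TotalOrder.Properties
  using (AllPairs⇒Sorted; Sorted⇒AllPairs)
open import Data.List.Relation.Unary.Unique.Propositional using (Unique)
import Data.List.Relation.Unary.Unique.Propositional.Properties as Unique
open import Data.Nat.Base using (zero; suc; _≤_; _<_; z≤n; s≤s; z<s)
open import Data.Nat.ListAction using (sum)
import Data.Nat.Properties as ℕ
open import Data.Nat.Properties using (_≟_; _≤?_; ≤-totalOrder)
open import Data.Product.Base using (∃₂; ∃-syntax; _×_; _,_)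
open import Data.Sum.Base using (inj₁; inj₂)
open import Function.Base using (_∘_)
open import Function.Bundles using (Equivalence; mk⇔)
open import Relation.Binary.Definitions using (tri<; tri≈; tri>)
open import Relation.Binary.PropositionalEquality.Core
  using (refl; sym; trans; cong; cong₂; subst)
open import Relation.Binary.PropositionalEquality.Properties using (module ≡-Reasoning)
open import Relation.Nullary using (yes; no; contradiction)

-- Counting partitions by the multiplicity of the smallest part.

atLeast exactly : ℕ → ℕ → List (List ℕ)
atLeast k n = filter (λ π → k ≤? smallestPartMultiplicity π) (partitions n)
exactly k n = filter (λ π → smallestPartMultiplicity π ≟ k) (partitions n)

a : ℕ → ℕ → ℕ
a k n = length (atLeast k n)

length-filter-≤? : ∀ {A : Set} (f : A → ℕ) k xs →
  length (filter (λ x → k ≤? f x) xs) ≡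
  length (filter (λ x → f x ≟ k) xs) ℕ.+ length (filter (λ x → suc k ≤? f x) xs)
length-filter-≤? f k [] = refl
length-filter-≤? f k (x ∷ xs) with ih ← length-filter-≤? f k xs with ℕ.<-cmp k (f x)
... | tri< k<f k≢f _
  rewrite filter-accept (λ y → k ≤? f y) {x} {xs} (ℕ.<⇒≤ k<f)
        | filter-reject (λ y → f y ≟ k) {x} {xs} (k≢f ∘ sym)
        | filter-accept (λ y → suc k ≤? f y) {x} {xs} k<f
  = trans (cong suc ih) (sym (ℕ.+-suc _ _))
... | tri≈ k≮f k≡f _
  rewrite filter-accept (λ y → k ≤? f y) {x} {xs} (ℕ.≤-reflexive k≡f)
        | filter-accept (λ y → f y ≟ k) {x} {xs} (sym k≡f)
        | filter-reject (λ y → suc k ≤? f y) {x} {xs} k≮f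
  = cong suc ih
... | tri> k≮f k≢f f<k
  rewrite filter-reject (λ y → k ≤? f y) {x} {xs} (ℕ.<⇒≱ f<k)
        | filter-reject (λ y → f y ≟ k) {x} {xs} (k≢f ∘ sym)
        | filter-reject (λ y → suc k ≤? f y) {x} {xs} k≮f
  = ih

-- Sorted lists that begin with a run of the smallest part.

multiplicity-∷ : ∀ x π → multiplicity x (x ∷ π) ≡ suc (multiplicity x π)
multiplicity-∷ x π = cong length (filter-accept (_≟ x) refl)

multiplicity-replicate-++ : ∀ k x σ →
  multiplicity x (replicate k x ++ σ) ≡ k ℕ.+ multiplicity x σ
multiplicity-replicate-++ zero    x σ = refl
multiplicity-replicate-++ (suc k) x σ = trans
  (multiplicity-∷ x (replicate k x ++ σ))
  (cong suc (multiplicity-replicate-++ k x σ))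

multiplicity-< : ∀ {x σ} → All (x <_) σ → multiplicity x σ ≡ 0
multiplicity-< {x} x<σ = cong length (filter-none (_≟ x) (All.map ℕ.>⇒≢ x<σ))

multiplicity≡0⇒< : ∀ {x σ} → All (x ≤_) σ → multiplicity x σ ≡ 0 → All (x <_) σ
multiplicity≡0⇒< []                  _  = []
multiplicity≡0⇒< {x} {y ∷ σ} (x≤y ∷ x≤σ) eq with y ≟ x
... | yes refl = contradiction (trans (sym (multiplicity-∷ x σ)) eq) λ ()
... | no y≢x   = ℕ.≤∧≢⇒< x≤y (y≢x ∘ sym) ∷
  multiplicity≡0⇒< x≤σ (trans (sym (cong length (filter-reject (_≟ x) y≢x))) eq)

min-head : ∀ {x xs} → All (x ≤_) xs → min x xs ≡ x
min-head {x} {xs} x≤xs = ℕ.≤-antisym (min≤⊤ x xs) (v≤min⁺ ℕ.≤-refl x≤xs)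

smallestPartMultiplicity-run : ∀ k {x σ} → All (x ≤_) σ →
  smallestPartMultiplicity (replicate (suc k) x ++ σ) ≡ suc k ℕ.+ multiplicity x σ
smallestPartMultiplicity-run k {x} {σ} x≤σ
  rewrite min-head (All.++⁺ (All.replicate⁺ k (ℕ.≤-refl {x})) x≤σ)
  = multiplicity-replicate-++ (suc k) x σ

-- In a sorted list bounded below by `x`, a head other than `x` exceeds `x`, and so does everything
-- after it, leaving no copy of `x`. Hence all copies of `x` stand in front. The rest `σ` may still
-- begin with `x`.
splitRun : ∀ k {x π} → AllPairs _≤_ π → All (x ≤_) π → k ≤ multiplicity x π →
  ∃[ σ ] π ≡ replicate k x ++ σ × AllPairs _≤_ σ × All (x ≤_) σ
splitRun zero    s x≤π _ = _ , refl , s , x≤π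
splitRun (suc k) {x} {y ∷ π} (y≤π ∷ s) (x≤y ∷ x≤π) k<m with y ≟ x
... | yes refl with σ , refl , s′ , x≤σ ←
       splitRun k s x≤π (ℕ.s≤s⁻¹ (subst (suc k ≤_) (multiplicity-∷ x π) k<m)) =
  σ , refl , s′ , x≤σ
... | no y≢x =
  contradiction (subst (suc k ≤_) (multiplicity-< (x<y ∷ All.map (ℕ.<-≤-trans x<y) y≤π)) k<m)
    λ ()
  where
  x<y : x < y
  x<y = ℕ.≤∧≢⇒< x≤y (y≢x ∘ sym)

smallestRun : ∀ k {n π} → π ∈ partitions n → suc k ≤ smallestPartMultiplicity π →
  ∃₂ λ x σ → π ≡ replicate (suc k) (suc x) ++ σ × AllPairs _≤_ σ × All (suc x ≤_) σ
smallestRun k {n} {x ∷ xs} π∈ k<m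
  -- Positivity of the head exhibits it as `suc y`; this `y` is the value of the run once lowered.
  with isPartition sorted (s≤s {n = y} _ ∷ _) _ ← Equivalence.to (∈-partitions n) π∈
  with s@(x≤xs ∷ _) ← Sorted⇒AllPairs ≤-totalOrder sorted
  with σ , eq , s′ , x≤σ ← splitRun (suc k) {x} s (ℕ.≤-refl ∷ x≤xs)
         (subst (λ m → suc k ≤ multiplicity m (x ∷ xs)) (min-head x≤xs) k<m)
  = y , σ , eq , s′ , x≤σ

AllPairs-replicate-++ : ∀ k {x σ} → AllPairs _≤_ σ → All (x ≤_) σ →
  AllPairs _≤_ (replicate k x ++ σ)
AllPairs-replicate-++ zero    s _   = s
AllPairs-replicate-++ (suc k) s x≤σ =
  All.++⁺ (All.replicate⁺ k ℕ.≤-refl) x≤σ ∷ AllPairs-replicate-++ k s x≤σ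

partition-run : ∀ k {n x σ} → AllPairs _≤_ σ → All (suc x ≤_) σ →
  sum (replicate k (suc x) ++ σ) ≡ n → replicate k (suc x) ++ σ ∈ partitions n
partition-run k {n} s x<σ eq = Equivalence.from (∈-partitions n) (isPartition
  (AllPairs⇒Sorted ≤-totalOrder (AllPairs-replicate-++ k s x<σ))
  (All.++⁺ (All.replicate⁺ k z<s) (All.map (ℕ.≤-<-trans z≤n) x<σ))
  eq)

-- Raising and lowering an initial run.

-- Acting on positions instead of on copies of the smallest part makes this map injective on all
-- lists, with no side conditions.
raise : ℕ → List ℕ → List ℕ
raise zero    xs       = xs
raise (suc k) []       = []
raise (suc k) (x ∷ xs) = suc x ∷ raise k xs

raise-injective : ∀ k {xs ys} → raise k xs ≡ raise k ys → xs ≡ ys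
raise-injective zero    eq = eq
raise-injective (suc k) {[]}    {[]}    _  = refl
raise-injective (suc k) {_ ∷ _} {_ ∷ _} eq with x≡y , xs≡ys ← ∷-injective eq =
  cong₂ _∷_ (ℕ.suc-injective x≡y) (raise-injective k xs≡ys)

raise-run : ∀ k x σ → raise k (replicate k x ++ σ) ≡ replicate k (suc x) ++ σ
raise-run zero    x σ = refl
raise-run (suc k) x σ = cong (suc x ∷_) (raise-run k x σ)

sum-run-suc : ∀ k x σ →
  sum (replicate k (suc x) ++ σ) ≡ sum (replicate k x ++ σ) ℕ.+ k
sum-run-suc zero    x σ = sym (ℕ.+-identityʳ _)
sum-run-suc (suc k) x σ = begin
  suc x ℕ.+ sum (replicate k (suc x) ++ σ)       ≡⟨ cong (suc x ℕ.+_) (sum-run-suc k x σ) ⟩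
  suc x ℕ.+ (sum (replicate k x ++ σ) ℕ.+ k)     ≡⟨ ℕ.+-assoc (suc x) _ k ⟨
  suc (x ℕ.+ sum (replicate k x ++ σ)) ℕ.+ k     ≡⟨ ℕ.+-suc _ k ⟨
  x ℕ.+ sum (replicate k x ++ σ) ℕ.+ suc k       ∎
  where open ≡-Reasoning

sum-zeros-++ : ∀ k σ → sum (replicate k 0 ++ σ) ≡ sum σ
sum-zeros-++ zero    σ = refl
sum-zeros-++ (suc k) σ = sum-zeros-++ k σ

-- The partitions counted by a k (n + k), with k copies of the smallest part
-- lowered by 1.
lowered : ℕ → ℕ → List (List ℕ)
lowered k n = map (replicate k 0 ++_) (partitions n) ++ exactly k n

-- Both halves of `lowered` have one shape: a run of `suc k` copies of `x` followed by strictly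
-- larger entries. The zero-padded partitions are the case `x = 0`, where strictness is positivity
-- of the parts. The bijection can thus be checked without cases.
lowered⁻ : ∀ k {n π} → π ∈ lowered (suc k) n →
  ∃₂ λ x σ → π ≡ replicate (suc k) x ++ σ × AllPairs _≤_ σ × All (x <_) σ × sum π ≡ n
lowered⁻ k {n} π∈ with ∈-++⁻ (map (replicate (suc k) 0 ++_) (partitions n)) π∈
... | inj₁ i
  with σ , σ∈ , refl ← ∈-map⁻ (replicate (suc k) 0 ++_) i
  with isPartition sorted pos eq ← Equivalence.to (∈-partitions n) σ∈
  = 0 , σ , refl , Sorted⇒AllPairs ≤-totalOrder sorted , pos , trans (sum-zeros-++ k σ) eq
... | inj₂ i
  with π∈n , m≡k ← ∈-filter⁻ (λ π → smallestPartMultiplicity π ≟ suc k) {xs = partitions n} i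
  with x , σ , refl , s , x≤σ ← smallestRun k {n} π∈n (ℕ.≤-reflexive (sym m≡k))
  = suc x , σ , refl , s
  -- The run already uses up all `suc k` copies, so `σ` contains none and the weak bound becomes
  -- strict.
  , multiplicity≡0⇒< x≤σ (ℕ.+-cancelˡ-≡ (suc k) _ 0
      (trans (sym (smallestPartMultiplicity-run k x≤σ)) (trans m≡k (sym (ℕ.+-identityʳ _)))))
  , IsPartition.total (Equivalence.to (∈-partitions n) π∈n)

lowered⁺ : ∀ k {n x σ} → AllPairs _≤_ σ → All (x <_) σ → sum (replicate (suc k) x ++ σ) ≡ n →
  replicate (suc k) x ++ σ ∈ lowered (suc k) n
lowered⁺ k {n} {zero} {σ} s 0<σ eq =
  ∈-++⁺ˡ (∈-map⁺ (replicate (suc k) 0 ++_)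
    -- An empty run: `0 <` unfolds to `1 ≤`, so `σ` alone is a partition, and the zeros do not
    -- affect the sum.
    (partition-run 0 s 0<σ (trans (sym (sum-zeros-++ k σ)) eq)))
lowered⁺ k {n} {suc x} {σ} s x<σ eq =
  ∈-++⁺ʳ (map (replicate (suc k) 0 ++_) (partitions n))
    (∈-filter⁺ (λ π → smallestPartMultiplicity π ≟ suc k)
      (partition-run (suc k) s x≤σ eq)
      (trans (smallestPartMultiplicity-run k x≤σ)
             (trans (cong (suc k ℕ.+_) (multiplicity-< x<σ)) (ℕ.+-identityʳ _))))
  where
  x≤σ : All (suc x ≤_) σ
  x≤σ = All.map ℕ.<⇒≤ x<σ

lowered-unique : ∀ k n → Unique (lowered (suc k) n)
lowered-unique k n = Unique.++⁺
  (Unique.map⁺ (++-cancelˡ (replicate (suc k) 0) _ _) (partitions-unique n))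
  (Unique.filter⁺ (λ π → smallestPartMultiplicity π ≟ suc k) (partitions-unique n))
  disjoint
  where
  disjoint : Disjoint (map (replicate (suc k) 0 ++_) (partitions n)) (exactly (suc k) n)
  -- A list in the first half begins with 0, which is impossible for a partition.
  disjoint (i , j)
    with _ , _ , refl ← ∈-map⁻ (replicate (suc k) 0 ++_) i
    with π∈ , _ ← ∈-filter⁻ (λ π → smallestPartMultiplicity π ≟ suc k) {xs = partitions n} j
    with () ∷ _ ← IsPartition.positive (Equivalence.to (∈-partitions n) π∈)

-- The bijection and the recurrence.

-- Duplicate-free lists with the same members are permutations of each other. Counts can thus be
-- compared regardless of the order of enumeration.
length-unique : ∀ {A : Set} {xs ys : List A} → Unique xs → Unique ys →
  (∀ {z} → z ∈ xs → z ∈ ys) → (∀ {z} → z ∈ ys → z ∈ xs) → length xs ≡ length ys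
length-unique u v f g = ↭-length (∼bag⇒↭ (unique∧set⇒bag u v (mk⇔ f g)))

-- Injectivity of `raise` keeps the image duplicate-free, so only equality of members remains.
-- Lowering need not be a function: `smallestRun` supplies the preimage.
a-lowered : ∀ k n → a (suc k) (n ℕ.+ suc k) ≡ length (map (raise (suc k)) (lowered (suc k) n))
a-lowered k n = length-unique
  (Unique.filter⁺ enough? (partitions-unique (n ℕ.+ suc k)))
  (Unique.map⁺ (raise-injective (suc k)) (lowered-unique k n))
  to from
  where
  enough? = λ π → suc k ≤? smallestPartMultiplicity π

  to : ∀ {π} → π ∈ atLeast (suc k) (n ℕ.+ suc k) → π ∈ map (raise (suc k)) (lowered (suc k) n)
  to π∈
    with π∈n , k<m ← ∈-filter⁻ enough? {xs = partitions (n ℕ.+ suc k)} π∈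
    -- The bound `suc x ≤` for the original run is by definition `x <` for the lowered run, just
    -- what `lowered⁺` asks for.
    with x , σ , refl , s , x<σ ← smallestRun k {n ℕ.+ suc k} π∈n k<m
    = subst (_∈ map (raise (suc k)) (lowered (suc k) n)) (raise-run (suc k) x σ)
        (∈-map⁺ (raise (suc k)) (lowered⁺ k s x<σ (ℕ.+-cancelʳ-≡ (suc k) _ n
          (trans (sym (sum-run-suc (suc k) x σ))
                 (IsPartition.total (Equivalence.to (∈-partitions (n ℕ.+ suc k)) π∈n))))))

  from : ∀ {π} → π ∈ map (raise (suc k)) (lowered (suc k) n) → π ∈ atLeast (suc k) (n ℕ.+ suc k)
  from π∈
    with _ , ρ∈ , refl ← ∈-map⁻ (raise (suc k)) π∈
    with x , σ , refl , s , x<σ , eq ← lowered⁻ k {n} ρ∈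
    = subst (_∈ atLeast (suc k) (n ℕ.+ suc k)) (sym (raise-run (suc k) x σ))
        (∈-filter⁺ enough?
          (partition-run (suc k) s x<σ
            (trans (sum-run-suc (suc k) x σ) (cong (ℕ._+ suc k) eq)))
          (subst (suc k ≤_) (sym (smallestPartMultiplicity-run k x<σ)) (ℕ.m≤m+n (suc k) _)))

-- Stated additively to avoid truncated subtraction: adding `a (suc (suc k)) n` completes the count
-- of `exactly (suc k) n` to `a (suc k) n`.
a-step : ∀ k n → a (suc k) (n ℕ.+ suc k) ℕ.+ a (suc (suc k)) n ≡ p n ℕ.+ a (suc k) n
a-step k n = begin
  a (suc k) (n ℕ.+ suc k) ℕ.+ a (suc (suc k)) n
    ≡⟨ cong (ℕ._+ a (suc (suc k)) n) (a-lowered k n) ⟩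
  length (map (raise (suc k)) (lowered (suc k) n)) ℕ.+ a (suc (suc k)) n
    ≡⟨ cong (ℕ._+ a (suc (suc k)) n) length-lowered ⟩
  p n ℕ.+ length (exactly (suc k) n) ℕ.+ a (suc (suc k)) n
    ≡⟨ ℕ.+-assoc (p n) _ _ ⟩
  p n ℕ.+ (length (exactly (suc k) n) ℕ.+ a (suc (suc k)) n)
    ≡⟨ cong (p n ℕ.+_) (length-filter-≤? smallestPartMultiplicity (suc k) (partitions n)) ⟨
  p n ℕ.+ a (suc k) n ∎
  where
  open ≡-Reasoning
  length-lowered : length (map (raise (suc k)) (lowered (suc k) n)) ≡
                   p n ℕ.+ length (exactly (suc k) n)
  length-lowered = trans (length-map (raise (suc k)) (lowered (suc k) n))
    (trans (length-++ (map (replicate (suc k) 0 ++_) (partitions n)))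
           (cong (ℕ._+ length (exactly (suc k) n))
                 (length-map (replicate (suc k) 0 ++_) (partitions n))))

a-suc : ∀ k n → + a (suc (suc k)) n ≡ + p n + + a (suc k) n - + a (suc k) (n ℕ.+ suc k)
a-suc k n = begin
  + z                 ≡⟨ isolate (+ y) (+ z) ⟩
  + y + + z - + y     ≡⟨ cong (_- + y) (cong +_ (a-step k n)) ⟩
  + p n + + x - + y   ∎
  where
  open ≡-Reasoning
  x = a (suc k) n
  y = a (suc k) (n ℕ.+ suc k)
  z = a (suc (suc k)) n
  isolate : ∀ y z → z ≡ y + z - y
  isolate = solve-∀

-- Unfolding the recurrence.

-- For `n ≥ 1` every partition has a smallest part, which occurs at least once. The empty partition,
-- with default multiplicity 0, is excluded.
a-one : ∀ n → n ℕ.≥ 1 → a 1 n ≡ p n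
a-one n n≥1 = cong length (filter-all (λ π → 1 ≤? smallestPartMultiplicity π)
  (All.tabulate (occurs ∘ Equivalence.to (∈-partitions n))))
  where
  occurs : ∀ {π} → IsPartition n π → 1 ≤ smallestPartMultiplicity π
  occurs {[]}     (isPartition _ _ refl) = contradiction n≥1 λ ()
  occurs {x ∷ xs} (isPartition sorted _ _)
    with x≤xs ∷ _ ← Sorted⇒AllPairs ≤-totalOrder sorted
    rewrite smallestPartMultiplicity-run 0 x≤xs = s≤s z≤n

a-two : ∀ n → n ℕ.≥ 1 → + a 2 n ≡ + 2 * + p n - + p (n ℕ.+ 1)
a-two n n≥1 = begin
  + a 2 n                            ≡⟨ a-suc 0 n ⟩
  + p n + + a 1 n - + a 1 (n ℕ.+ 1)
    ≡⟨ cong₂ (λ x y → + p n + + x - + y) (a-one n n≥1) (a-one (n ℕ.+ 1) (ℕ.m≤n⇒m≤n+o 1 n≥1)) ⟩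
  + p n + + p n - + p (n ℕ.+ 1)      ≡⟨ collect (+ p n) (+ p (n ℕ.+ 1)) ⟩
  + 2 * + p n - + p (n ℕ.+ 1)        ∎
  where
  open ≡-Reasoning
  collect : ∀ p₀ p₁ → p₀ + p₀ - p₁ ≡ + 2 * p₀ - p₁
  collect = solve-∀

a-three : ∀ n → n ℕ.≥ 1 →
  + a 3 n ≡ + 3 * + p n - + p (n ℕ.+ 1) - + 2 * + p (n ℕ.+ 2) + + p (n ℕ.+ 3)
a-three n n≥1 = begin
  + a 3 n                            ≡⟨ a-suc 1 n ⟩
  + p n + + a 2 n - + a 2 (n ℕ.+ 2)
    ≡⟨ cong₂ (λ x y → + p n + x - y) (a-two n n≥1) shifted ⟩
  + p n + (+ 2 * + p n - + p (n ℕ.+ 1)) - (+ 2 * + p (n ℕ.+ 2) - + p (n ℕ.+ 3))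
    ≡⟨ collect (+ p n) (+ p (n ℕ.+ 1)) (+ p (n ℕ.+ 2)) (+ p (n ℕ.+ 3)) ⟩
  + 3 * + p n - + p (n ℕ.+ 1) - + 2 * + p (n ℕ.+ 2) + + p (n ℕ.+ 3) ∎
  where
  open ≡-Reasoning
  shifted : + a 2 (n ℕ.+ 2) ≡ + 2 * + p (n ℕ.+ 2) - + p (n ℕ.+ 3)
  shifted = trans (a-two (n ℕ.+ 2) (ℕ.m≤n⇒m≤n+o 2 n≥1))
                  (cong (λ m → + 2 * + p (n ℕ.+ 2) - + p m) (ℕ.+-assoc n 2 1))
  collect : ∀ p₀ p₁ p₂ p₃ →
    p₀ + (+ 2 * p₀ - p₁) - (+ 2 * p₂ - p₃) ≡ + 3 * p₀ - p₁ - + 2 * p₂ + p₃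
  collect = solve-∀

theorem1p5 : (n : ℕ) → n ℕ.≥ 1 →
    + a₄ n ≡ + 4 * + p n - + p (n ℕ.+ 1) - + 2 * + p (n ℕ.+ 2) - + 2 * + p (n ℕ.+ 3)
    + + p (n ℕ.+ 4) + + 2 * + p (n ℕ.+ 5) - + p (n ℕ.+ 6)
theorem1p5 n n≥1 = begin
  -- `a₄ n` is `a 4 n` by definition.
  + a 4 n                            ≡⟨ a-suc 2 n ⟩
  + p n + + a 3 n - + a 3 (n ℕ.+ 3)
    ≡⟨ cong₂ (λ x y → + p n + x - y) (a-three n n≥1) shifted ⟩
  + p n + (+ 3 * + p n - + p (n ℕ.+ 1) - + 2 * + p (n ℕ.+ 2) + + p (n ℕ.+ 3))
    - (+ 3 * + p (n ℕ.+ 3) - + p (n ℕ.+ 4) - + 2 * + p (n ℕ.+ 5) + + p (n ℕ.+ 6))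
    ≡⟨ collect (+ p n) (+ p (n ℕ.+ 1)) (+ p (n ℕ.+ 2)) (+ p (n ℕ.+ 3))
               (+ p (n ℕ.+ 4)) (+ p (n ℕ.+ 5)) (+ p (n ℕ.+ 6)) ⟩
  + 4 * + p n - + p (n ℕ.+ 1) - + 2 * + p (n ℕ.+ 2) - + 2 * + p (n ℕ.+ 3)
    + + p (n ℕ.+ 4) + + 2 * + p (n ℕ.+ 5) - + p (n ℕ.+ 6) ∎
  where
  open ≡-Reasoning
  -- The recurrence for `a 3` shifts by 3, so the formula is applied at `n + 3` and its arguments
  -- reassociated.
  shifted : + a 3 (n ℕ.+ 3) ≡
    + 3 * + p (n ℕ.+ 3) - + p (n ℕ.+ 4) - + 2 * + p (n ℕ.+ 5) + + p (n ℕ.+ 6)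
  shifted = trans (a-three (n ℕ.+ 3) (ℕ.m≤n⇒m≤n+o 3 n≥1)) (cong₂ _+_
        (cong₂ (λ i j → + 3 * + p (n ℕ.+ 3) - + p i - + 2 * + p j)
               (ℕ.+-assoc n 3 1) (ℕ.+-assoc n 3 2))
        (cong (+_ ∘ p) (ℕ.+-assoc n 3 3)))
  collect : ∀ p₀ p₁ p₂ p₃ p₄ p₅ p₆ →
    p₀ + (+ 3 * p₀ - p₁ - + 2 * p₂ + p₃) - (+ 3 * p₃ - p₄ - + 2 * p₅ + p₆) ≡
    + 4 * p₀ - p₁ - + 2 * p₂ - + 2 * p₃ + p₄ + + 2 * p₅ - p₆
  collect = solve-∀
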